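{- Let $G$ be a connected graph without isolated vertices (i.e. with at least two vertices). Then (1) $\chi_{ON}(G)\le 2\,\mathrm{tw}(G)+1$; (2) $\chi_{ON}(G)\le \mathrm{fvs}(G)+3$; (3) $\chi_{ON}(G)\le \mathrm{vc}(G)+1$, and if moreover $G$ is neither a star graph nor an edge-star graph, then $\chi_{ON}(G)\le\mathrm{vc}(G)$.
   Context: A $q$-ONCF-coloring of a graph $G$ is a map $c\colon V(G)\to\{1,\dots,q\}$ such that for every vertex $v$ the open neighborhood $N(v)$ contains a vertex $u$ with $c(u)\neq c(w)$ for all $w\in N(v)\setminus\{u\}$. $\chi_{ON}(G)$ is the minimum $q$ for which $G$ has a $q$-ONCF-coloring. $\mathrm{tw}(G)$, $\mathrm{fvs}(G)$, $\mathrm{vc}(G)$ denote the treewidth, the size of a minimum feedback vertex set, and the size of a minimum vertex cover of $G$. An edge-star graph is a graph with a central edge $\{u,v\}$ such that every other vertex $w$ has $N(w)=\{u,v\}$ (e.g. a triangle). -}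

module Defs where

open import Data.Nat using (ℕ; suc; _≤_; _+_; _*_)
open import Data.Fin using (Fin)
open import Data.Fin.Subset using (Subset; _∈_; _∉_; ∣_∣)
open import Data.Bool using (Bool; true; false)
open import Data.List using (List; []; _∷_; _++_; [_]; length)
open import Data.List.Relation.Unary.All using (All)
open import Data.List.Relation.Unary.Unique.Propositional using (Unique)
open import Data.Product using (Σ; ∃; ∃-syntax; _×_)
open import Data.Sum using (_⊎_)
open import Data.Unit using (⊤)
open import Relation.Nullary using (¬_)
open import Relation.Binary.PropositionalEquality using (_≡_; _≢_)

record Graph (n : ℕ) : Set where
  field
    E      : Fin n → Fin n → Bool
    sym    : ∀ u v → E u v ≡ E v u
    irrefl : ∀ v → E v v ≡ false

open Graph public

Adj : ∀ {n} → Graph n → Fin n → Fin n → Set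
Adj G u v = E G u v ≡ true

data ReachWithin {n} (G : Graph n) (P : Fin n → Set) : Fin n → Fin n → Set where
  here : ∀ {u} → P u → ReachWithin G P u u
  step : ∀ {u w v} → P u → Adj G u w → ReachWithin G P w v → ReachWithin G P u v

Connected : ∀ {n} → Graph n → Set
Connected {n} G = ∀ (u v : Fin n) → ReachWithin G (λ _ → ⊤) u v

PathAdj : ∀ {n} → Graph n → List (Fin n) → Set
PathAdj G []           = ⊤
PathAdj G (x ∷ [])     = ⊤
PathAdj G (x ∷ y ∷ r)  = Adj G x y × PathAdj G (y ∷ r)

record CycleWithin {n} (G : Graph n) (P : Fin n → Set) : Set where
  field
    x      : Fin n
    xs     : List (Fin n)
    long   : 2 ≤ length xs
    unique : Unique (x ∷ xs)
    adj    : PathAdj G ((x ∷ xs) ++ [ x ])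
    inP    : All P (x ∷ xs)

AcyclicWithin : ∀ {n} → Graph n → (Fin n → Set) → Set
AcyclicWithin G P = ¬ CycleWithin G P

IsTree : ∀ {m} → Graph m → Set
IsTree T = Connected T × AcyclicWithin T (λ _ → ⊤)

IsONCF : ∀ {n} (G : Graph n) (q : ℕ) → (Fin n → Fin q) → Set
IsONCF {n} G q c =
  ∀ (v : Fin n) → ∃[ u ] (Adj G v u × (∀ w → Adj G v w → w ≢ u → c w ≢ c u))

HasONCF : ∀ {n} → Graph n → ℕ → Set
HasONCF {n} G q = Σ (Fin n → Fin q) (IsONCF G q)

IsVertexCover : ∀ {n} → Graph n → Subset n → Set
IsVertexCover G S = ∀ u v → Adj G u v → u ∈ S ⊎ v ∈ S

IsFVS : ∀ {n} → Graph n → Subset n → Set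
IsFVS G S = AcyclicWithin G (λ v → v ∉ S)

record TreeDecomp {n} (G : Graph n) (k : ℕ) : Set where
  field
    m        : ℕ
    T        : Graph m
    isTree   : IsTree T
    bag      : Fin m → Subset n
    covV     : ∀ v → ∃[ t ] (v ∈ bag t)
    covE     : ∀ u v → Adj G u v → ∃[ t ] (u ∈ bag t × v ∈ bag t)
    coherent : ∀ v t t' → v ∈ bag t → v ∈ bag t' →
               ReachWithin T (λ s → v ∈ bag s) t t'
    width    : ∀ t → ∣ bag t ∣ ≤ suc k

IsStar : ∀ {n} → Graph n → Set
IsStar {n} G = ∃[ c ] ((∀ v → v ≢ c → Adj G c v) × (∀ u v → Adj G u v → u ≡ c ⊎ v ≡ c))

IsEdgeStar : ∀ {n} → Graph n → Set
IsEdgeStar {n} G = ∃[ a ] ∃[ b ] (Adj G a b ×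
  (∀ w → w ≢ a → w ≢ b → ∀ x → (Adj G w x → x ≡ a ⊎ x ≡ b) × (x ≡ a ⊎ x ≡ b → Adj G w x)))

{-# OPTIONS --safe #-}
-- In all bounds every vertex v gets a chosen neighbour f v, whose colour must differ from that of every
-- other neighbour of v.
--
-- Treewidth: order the vertices by the position of their topmost bag, and let f v be the first neighbour of v.
-- If v ~ w and f v precedes w, then either v precedes w, and v lies in the topmost bag of w, or w precedes v,
-- and then f v and w share the topmost bag of v, so f v lies in the topmost bag of w. Hence w conflicts with at
-- most 2k earlier vertices, and greedy colouring needs 2k + 1 colours.
--
-- Feedback vertex set S: give each s in S its own name as colour, and 2-colour the forest outside S by adding
-- leaves. Only the lonely s, those without neighbour in S, remain; for them f s is coloured s. This can only
-- hurt a vertex adjacent to both s and f s; so f s is chosen without neighbours outside S if possible, and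
-- otherwise s itself is recoloured with a third extra colour.
--
-- Vertex cover S: the same colouring, where the vertices outside S that are not some f s may all share one extra
-- colour. If G is not a star or an edge-star, the name of a vertex of S can be spared for them: either some
-- vertex has two neighbours in S, or two vertices of S at distance two, one of them lonely, can share their
-- witness, or S induces a perfect matching, which is treated by hand.
module Submission where

open import Defs
open import Data.Bool using (Bool; true; false; not)
import Data.Bool.Properties as Bool
open import Data.Fin using (Fin; zero; suc; toℕ; join; splitAt)
open import Data.Fin.Properties using (_≟_; any?; all?; toℕ<n; toℕ-injective; injective⇒≤; splitAt-join)
open import Data.Fin.Subset using (Subset; inside; outside; _∈_; _∉_; ∣_∣; Nonempty; Empty; ∁; _─_; _-_) renaming (⊤ to full)
open import Data.Fin.Subset.Induction using (Acc; acc; ⊂-wellFounded)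
open import Data.Fin.Subset.Properties using (_∈?_; nonempty?; ∈⊤; p─q⊆p; x∈⁅x⁆; x∈p∧x≢y⇒x∈p-y; x∈p⇒p-x⊂p; x∈p⇒∣p-x∣<∣p∣; x∈∁p⇒x∉p; x∉p⇒x∈∁p)
open import Data.List using (List; []; _∷_; _++_; [_]; length; lookup; map)
import Data.List.Membership.DecPropositional as DecMembership
import Data.List.Membership.Propositional as List
open import Data.List.Membership.Propositional.Properties using (∈-map⁺; ∈-++⁺ˡ; ∈-++⁺ʳ; ∈-lookup)
open import Data.List.Properties using (length-map; length-++)
open import Data.List.Relation.Unary.All using (All; []; _∷_)
import Data.List.Relation.Unary.All as All
open import Data.List.Relation.Unary.AllPairs using ([]; _∷_)
open import Data.List.Relation.Unary.Any using (here; there; index)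
open import Data.List.Relation.Unary.Any.Properties using (lookup-index)
open import Data.List.Relation.Unary.Unique.Propositional using (Unique)
open import Data.Nat using (ℕ; zero; suc; _≤_; _<_; _+_; _*_; z≤n; s≤s; s≤s⁻¹; _<?_)
open import Data.Nat.Induction using (<-wellFounded)
open import Data.Nat.Properties hiding (_≟_)
open import Data.Product using (∃; ∃₂; ∃-syntax; _×_; _,_; proj₁; proj₂)
open import Data.Sum using (_⊎_; inj₁; inj₂)
import Data.Sum as Sum
open import Data.Sum.Properties using (inj₁-injective; inj₂-injective)
open import Data.Unit using (⊤; tt)
open import Data.Vec using (here; there; []; _∷_)
open import Data.Vec.Functional using (updateAt)
open import Data.Vec.Functional.Properties using (updateAt-updates; updateAt-minimal)
open import Function using (_∘_; id; const)
open import Relation.Binary using (tri<; tri≈; tri>)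
open import Relation.Binary.PropositionalEquality as ≡ using (_≡_; _≢_; refl; cong; subst; trans)
open import Relation.Nullary using (¬_; Dec; yes; no; contradiction; ¬?; _×-dec_; _→-dec_; _⊎-dec_)
open import Relation.Nullary.Decidable using (decidable-stable)
open import Relation.Unary using (Decidable)

-- Graphs and conflict-free vertices

module _ {n} (G : Graph n) where

  adj? : ∀ u v → Dec (Adj G u v)
  adj? u v = E G u v Bool.≟ true

  adj-sym : ∀ {u v} → Adj G u v → Adj G v u
  adj-sym {u} {v} = trans (sym G v u)

  adj-irrefl : ∀ {v} → ¬ Adj G v v
  adj-irrefl {v} v~v with () ← trans (≡.sym v~v) (irrefl G v)

  adj⇒≢ : ∀ {u v} → Adj G u v → u ≢ v
  adj⇒≢ u~v refl = adj-irrefl u~v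

  exit-edge : ∀ {P X : Fin n → Set} {u v} → Decidable X → ReachWithin G P u v → X u → ¬ X v →
    ∃₂ λ p q → Adj G p q × X p × ¬ X q
  exit-edge X? (here _) Xu ¬Xv = contradiction Xu ¬Xv
  exit-edge X? (step {u} {w} _ u~w w⇝v) Xu ¬Xv with X? w
  ... | yes Xw = exit-edge X? w⇝v Xw ¬Xv
  ... | no ¬Xw = u , w , u~w , Xu , ¬Xw

  acyclic-mono : ∀ {P Q : Fin n → Set} → (∀ {v} → P v → Q v) → AcyclicWithin G Q → AcyclicWithin G P
  acyclic-mono P⊆Q acyclic C = acyclic record
    { x = x ; xs = xs ; long = long ; unique = unique ; adj = adj ; inP = All.map P⊆Q inP }
    where open CycleWithin C

  connected⇒neighbour : 2 ≤ n → Connected G → ∀ v → ∃[ u ] Adj G v u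
  connected⇒neighbour (s≤s (s≤s _)) conn zero with conn zero (suc zero)
  ... | step _ v~u _ = _ , v~u
  connected⇒neighbour (s≤s (s≤s _)) conn (suc v) with conn (suc v) zero
  ... | step _ v~u _ = _ , v~u

  -- Uniqueness is put contrapositively to suit case analysis on an equation between colours, and
  -- the colour type stays open until colours are counted.
  ConflictFreeAt : {C : Set} → (Fin n → C) → Fin n → Set
  ConflictFreeAt c v = ∃[ u ] (Adj G v u × (∀ w → Adj G v w → c w ≡ c u → w ≡ u))

  conflictFree⇒HasONCF : ∀ {C : Set} {q} (c : Fin n → C) (e : Fin n → Fin q) →
    (∀ u v → e u ≡ e v → c u ≡ c v) → (∀ v → ConflictFreeAt c v) → HasONCF G q
  conflictFree⇒HasONCF c e e-reflects cf = e , λ v →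
    let u , v~u , unique = cf v in
    u , v~u , λ w v~w w≢u ew≡eu → w≢u (unique w v~w (e-reflects w u ew≡eu))

-- Finite sets

≢⇒<⊎> : ∀ {a b} → a ≢ b → a < b ⊎ b < a
≢⇒<⊎> {a} {b} a≢b with <-cmp a b
... | tri< a<b _ _  = inj₁ a<b
... | tri≈ _ a≡b _  = contradiction a≡b a≢b
... | tri> _ _ b<a  = inj₂ b<a

argmin : ∀ {n} {P : Fin n → Set} (κ : Fin n → ℕ) → Decidable P → ∃ P →
  ∃[ x ] (P x × (∀ y → P y → κ x ≤ κ y))
argmin {n} {P} κ P? (x , Px) = go x Px (<-wellFounded (κ x))
  where
  go : ∀ x → P x → Acc _<_ (κ x) → ∃[ x ] (P x × (∀ y → P y → κ x ≤ κ y))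
  go x Px (acc rs) with any? (λ y → P? y ×-dec (κ y <? κ x))
  ... | yes (y , Py , y<x) = go y Py (rs y<x)
  ... | no none = x , Px , λ y Py → ≮⇒≥ (λ y<x → none (y , Py , y<x))

elements : ∀ {n} → Subset n → List (Fin n)
elements []            = []
elements (inside ∷ p)  = zero ∷ map suc (elements p)
elements (outside ∷ p) = map suc (elements p)

length-elements : ∀ {n} (p : Subset n) → length (elements p) ≡ ∣ p ∣
length-elements []            = refl
length-elements (inside ∷ p)  = cong suc (trans (length-map suc (elements p)) (length-elements p))
length-elements (outside ∷ p) = trans (length-map suc (elements p)) (length-elements p)

∈-elements : ∀ {n x} {p : Subset n} → x ∈ p → x List.∈ elements p
∈-elements here = here refl
∈-elements {p = inside ∷ p}  (there x∈p) = there (∈-map⁺ suc (∈-elements x∈p))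
∈-elements {p = outside ∷ p} (there x∈p) = ∈-map⁺ suc (∈-elements x∈p)

index-injective : ∀ {A : Set} {x y : A} {xs} (p : x List.∈ xs) (q : y List.∈ xs) → index p ≡ index q → x ≡ y
index-injective {xs = xs} p q eq =
  trans (lookup-index p) (trans (cong (lookup xs) eq) (≡.sym (lookup-index q)))

x∈p─q⇒x∉q : ∀ {n x} (p q : Subset n) → x ∈ p ─ q → x ∉ q
x∈p─q⇒x∉q (_ ∷ p) (outside ∷ q) (there x∈p─q) (there x∈q) = x∈p─q⇒x∉q p q x∈p─q x∈q
x∈p─q⇒x∉q (_ ∷ p) (inside ∷ q)  (there x∈p─q) (there x∈q) = x∈p─q⇒x∉q p q x∈p─q x∈q

x∈p-y⇒x≢y : ∀ {n x y} (p : Subset n) → x ∈ p - y → x ≢ y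
x∈p-y⇒x≢y p x∈p-y refl = x∈p─q⇒x∉q p _ x∈p-y (x∈⁅x⁆ _)

lookup-unique-injective : ∀ {A : Set} {xs : List A} → Unique xs → ∀ i j → lookup xs i ≡ lookup xs j → i ≡ j
lookup-unique-injective (_ ∷ _) zero zero eq = refl
lookup-unique-injective {xs = x ∷ xs} (x∉xs ∷ _) zero (suc j) eq = contradiction eq (All.lookup x∉xs (∈-lookup j))
lookup-unique-injective {xs = x ∷ xs} (x∉xs ∷ _) (suc i) zero eq = contradiction (≡.sym eq) (All.lookup x∉xs (∈-lookup i))
lookup-unique-injective (_ ∷ u) (suc i) (suc j) eq = cong suc (lookup-unique-injective u i j eq)

unique⇒length≤ : ∀ {n} {xs : List (Fin n)} → Unique xs → length xs ≤ n
unique⇒length≤ u = injective⇒≤ (λ {i} {j} → lookup-unique-injective u i j)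

-- Pigeonhole: if every colour occurred in `xs`, the index of an occurrence would inject `Fin q`
-- into a smaller set.
unused-colour : ∀ {q} (xs : List (Fin q)) → length xs < q → ∃[ x ] (x List.∉ xs)
unused-colour xs short with any? (λ x → ¬? (DecMembership._∈?_ _≟_ x xs))
... | yes found = found
... | no none = contradiction (injective⇒≤ {f = index ∘ used} (λ {x} {y} → index-injective (used x) (used y))) (<⇒≱ short)
  where
  used : ∀ x → x List.∈ xs
  used x = decidable-stable (DecMembership._∈?_ _≟_ x xs) (λ x∉xs → none (x , x∉xs))

-- Leaf elimination in forests

module _ {n} (G : Graph n) where

  AtMostOneNeighbour : Subset n → Fin n → Set
  AtMostOneNeighbour R x = ∀ a b → a ∈ R → b ∈ R → Adj G x a → Adj G x b → a ≡ b

  Branching : Subset n → Fin n → Set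
  Branching R x = ∃₂ λ a b → a ∈ R × b ∈ R × Adj G x a × Adj G x b × a ≢ b

  branching? : ∀ R → Decidable (Branching R)
  branching? R x = any? λ a → any? λ b →
    (a ∈? R) ×-dec (b ∈? R) ×-dec adj? G x a ×-dec adj? G x b ×-dec ¬? (a ≟ b)

  -- `zs` is the initial segment of `rest` that ends at `y`, where the edge to `h` closes the walk.
  close-path : ∀ {h y} rest → y List.∈ rest → Unique rest → Adj G y h →
    ∃[ zs ] (1 ≤ length zs × Unique zs × (∀ {v} → v List.∈ zs → v List.∈ rest)
             × (∀ x → PathAdj G (x ∷ rest) → PathAdj G (x ∷ zs ++ [ h ])))
  close-path {y = y} (y ∷ rest) (here refl) u y~h =
    [ y ] , s≤s z≤n , [] ∷ [] , (λ { (here eq) → here eq }) , λ x (x~y , _) → x~y , y~h , tt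
  close-path (z ∷ rest) (there y∈rest) (z∉rest ∷ u) y~h =
    let zs , _ , u′ , zs⊆rest , adj = close-path rest y∈rest u y~h in
    z ∷ zs , s≤s z≤n , All.tabulate (All.lookup z∉rest ∘ zs⊆rest) ∷ u′ ,
    (λ { (here eq) → here eq ; (there v∈zs) → there (zs⊆rest v∈zs) }) ,
    λ x (x~z , path) → x~z , adj z path

  -- The head `h` has a neighbour in `R` other than its predecessor `p`; it either lies on the path
  -- and closes a cycle, or lengthens the path. Once `fuel` is spent the path has more than `n`
  -- distinct vertices, which is absurd.
  extend-path : ∀ {R} → (∀ {x} → x ∈ R → Branching R x) → ∀ fuel h p rest →
    n < length (h ∷ p ∷ rest) + fuel → Unique (h ∷ p ∷ rest) → PathAdj G (h ∷ p ∷ rest) →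
    All (_∈ R) (h ∷ p ∷ rest) → CycleWithin G (_∈ R)
  extend-path branch zero h p rest big u _ _ =
    contradiction (unique⇒length≤ u) (<⇒≱ (subst (n <_) (+-identityʳ _) big))
  extend-path {R} branch (suc fuel) h p rest big u@((h≢p ∷ h∉rest) ∷ (p∉rest ∷ u-rest)) path@(h~p , path-p) allR@(h∈R ∷ p∈R ∷ rest⊆R)
    with branch h∈R
  ... | a , b , a∈R , b∈R , h~a , h~b , a≢b = choose
    where
    advance : ∀ y → y ∈ R → Adj G h y → y ≢ p → CycleWithin G (_∈ R)
    advance y y∈R h~y y≢p with DecMembership._∈?_ _≟_ y rest
    ... | yes y∈rest =
      let zs , long , u-zs , zs⊆rest , adj = close-path rest y∈rest u-rest (adj-sym G h~y) in
      record
        { x = h ; xs = p ∷ zs ; long = s≤s long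
        ; unique = (h≢p ∷ All.tabulate (All.lookup h∉rest ∘ zs⊆rest))
                   ∷ All.tabulate (All.lookup p∉rest ∘ zs⊆rest) ∷ u-zs
        ; adj = h~p , adj p path-p
        ; inP = h∈R ∷ p∈R ∷ All.tabulate (All.lookup rest⊆R ∘ zs⊆rest) }
    ... | no y∉rest = extend-path branch fuel y h (p ∷ rest)
      (subst (n <_) (+-suc (length (h ∷ p ∷ rest)) fuel) big)
      ((adj⇒≢ G (adj-sym G h~y) ∷ y≢p ∷ All.tabulate λ { v∈rest refl → y∉rest v∈rest }) ∷ u)
      (adj-sym G h~y , path) (y∈R ∷ allR)
    choose : CycleWithin G (_∈ R)
    choose with a ≟ p
    ... | no a≢p = advance a a∈R h~a a≢p
    ... | yes refl = advance b b∈R h~b (a≢b ∘ ≡.sym)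

  acyclic⇒leaf : ∀ {R} → AcyclicWithin G (_∈ R) → Nonempty R → ∃[ x ] (x ∈ R × AtMostOneNeighbour R x)
  acyclic⇒leaf {R} acyclic (r , r∈R) with any? (λ x → (x ∈? R) ×-dec ¬? (branching? R x))
  ... | yes (x , x∈R , ¬branching) = x , x∈R , λ a b a∈R b∈R x~a x~b →
    decidable-stable (a ≟ b) (λ a≢b → ¬branching (a , b , a∈R , b∈R , x~a , x~b , a≢b))
  ... | no none = contradiction cycle acyclic
    where
    branch : ∀ {x} → x ∈ R → Branching R x
    branch {x} x∈R = decidable-stable (branching? R x) (λ ¬b → none (x , x∈R , ¬b))
    cycle : CycleWithin G (_∈ R)
    cycle with branch r∈R
    ... | a , _ , a∈R , _ , r~a , _ = extend-path branch n a r [] (m≤n+m (suc n) 1)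
      ((adj⇒≢ G (adj-sym G r~a) ∷ []) ∷ [] ∷ []) (adj-sym G r~a , tt) (a∈R ∷ r∈R ∷ [])

  -- The induction scheme for forests: it serves both to 2-colour a forest and to root a
  -- decomposition tree.
  data LeafElimination (R : Subset n) : Set where
    done   : Empty R → LeafElimination R
    remove : ∀ x → x ∈ R → AtMostOneNeighbour R x → LeafElimination (R - x) → LeafElimination R

  acyclic⇒elimination : ∀ R → AcyclicWithin G (_∈ R) → LeafElimination R
  acyclic⇒elimination R = go R (⊂-wellFounded R)
    where
    go : ∀ R → Acc _ R → AcyclicWithin G (_∈ R) → LeafElimination R
    go R (acc rs) acyclic with nonempty? R
    ... | no empty = done empty
    ... | yes ne with acyclic⇒leaf acyclic ne
    ... | x , x∈R , leaf = remove x x∈R leaf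
      (go (R - x) (rs (x∈p⇒p-x⊂p x∈R)) (acyclic-mono G (p─q⊆p R _) acyclic))

  -- A two-colour ONCF-coloring of the subgraph induced by `R`. Vertices isolated in it are exempt,
  -- as they can have no witness there.
  ForestColouring : Subset n → (Fin n → Bool) → Set
  ForestColouring R c = ∀ v → v ∈ R → (∃[ u ] (u ∈ R × Adj G v u)) →
    ∃[ p ] (p ∈ R × Adj G v p × (∀ w → w ∈ R → Adj G v w → c w ≡ c p → w ≡ p))

  -- Putting the leaf `x` back affects only its neighbour. If that neighbour already has a witness,
  -- `x` avoids the colour of the witness; otherwise `x` is its only neighbour and becomes the
  -- witness.
  forest-colouring : ∀ {R} → LeafElimination R → ∃ (ForestColouring R)
  forest-colouring (done empty) = const true , λ v v∈R → contradiction (v , v∈R) empty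
  forest-colouring {R} (remove x x∈R leaf elim) = c′ , good′
    where
    R′ = R - x
    c = proj₁ (forest-colouring elim)
    good = proj₂ (forest-colouring elim)

    keep : ∀ {v} → v ∈ R → v ≢ x → v ∈ R′
    keep = x∈p∧x≢y⇒x∈p-y

    HasNeighbour : Fin n → Set
    HasNeighbour v = ∃[ u ] (u ∈ R′ × Adj G v u)

    hasNeighbour? : Decidable HasNeighbour
    hasNeighbour? v = any? λ u → (u ∈? R′) ×-dec adj? G v u

    Witness : Fin n → Fin n → Set
    Witness v p = p ∈ R′ × Adj G v p × (∀ w → w ∈ R′ → Adj G v w → c w ≡ c p → w ≡ p)

    -- Although stated for every neighbour `v` of `x`, this concerns one vertex, since `leaf`
    -- identifies them all; so a single `b` suffices.
    leaf-colour : ∃[ b ] (∀ v → v ∈ R′ → Adj G v x → HasNeighbour v → ∃[ p ] (Witness v p × b ≢ c p))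
    leaf-colour with hasNeighbour? x
    ... | no isolated = true , λ v v∈R′ v~x _ → contradiction (v , v∈R′ , adj-sym G v~x) isolated
    ... | yes (u , u∈R′ , x~u) with hasNeighbour? u
    ...   | no ¬nb = true , λ v v∈R′ v~x nb →
      contradiction (subst HasNeighbour (leaf v u (p─q⊆p R _ v∈R′) (p─q⊆p R _ u∈R′) (adj-sym G v~x) x~u) nb) ¬nb
    ...   | yes nb with good u u∈R′ nb
    ...     | p , p-witness = not (c p) , λ v v∈R′ v~x _ →
      p , subst (λ y → Witness y p) (leaf u v (p─q⊆p R _ u∈R′) (p─q⊆p R _ v∈R′) x~u (adj-sym G v~x)) p-witness ,
      Bool.not-¬ refl ∘ ≡.sym

    b = proj₁ leaf-colour
    c′ = updateAt c x (const b)

    c′≡c : ∀ {v} → v ≢ x → c′ v ≡ c v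
    c′≡c v≢x = updateAt-minimal _ x c v≢x

    extend : ∀ v p → Witness v p → (Adj G v x → b ≢ c p) →
      ∃[ p ] (p ∈ R × Adj G v p × (∀ w → w ∈ R → Adj G v w → c′ w ≡ c′ p → w ≡ p))
    extend v p (p∈R′ , v~p , unique) b≢ = p , p─q⊆p R _ p∈R′ , v~p , unique′
      where
      unique′ : ∀ w → w ∈ R → Adj G v w → c′ w ≡ c′ p → w ≡ p
      unique′ w w∈R v~w eq with w ≟ x
      ... | yes refl = contradiction
        (trans (≡.sym (updateAt-updates x c)) (trans eq (c′≡c (x∈p-y⇒x≢y R p∈R′)))) (b≢ v~w)
      ... | no w≢x = unique w (keep w∈R w≢x) v~w
        (trans (≡.sym (c′≡c w≢x)) (trans eq (c′≡c (x∈p-y⇒x≢y R p∈R′))))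

    good′ : ForestColouring R c′
    good′ v v∈R (u , u∈R , v~u) with v ≟ x
    ... | yes refl = u , u∈R , v~u , λ w w∈R v~w _ → leaf w u w∈R u∈R v~w v~u
    ... | no v≢x with hasNeighbour? v | adj? G v x
    ...   | yes nb | no v≁x =
      let p , w = good v (keep v∈R v≢x) nb in extend v p w (λ v~x → contradiction v~x v≁x)
    ...   | yes nb | yes v~x =
      let p , w , b≢ = proj₂ leaf-colour v (keep v∈R v≢x) v~x nb in extend v p w (const b≢)
    ...   | no ¬nb | _ = u , u∈R , v~u , λ w w∈R v~w _ → trans (only-x w w∈R v~w) (≡.sym (only-x u u∈R v~u))
      where
      only-x : ∀ w → w ∈ R → Adj G v w → w ≡ x
      only-x w w∈R v~w = decidable-stable (w ≟ x) (λ w≢x → ¬nb (w , keep w∈R w≢x , v~w))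

  rank-bound : ∀ {R} → LeafElimination R → ℕ
  rank-bound (done _) = 0
  rank-bound (remove _ _ _ elim) = suc (rank-bound elim)

  -- The reverse of the removal order: the first vertex removed ranks highest.
  rank : ∀ {R} → LeafElimination R → Fin n → ℕ
  rank (done _) v = 0
  rank (remove x _ _ elim) v with v ≟ x
  ... | yes _ = rank-bound elim
  ... | no _  = rank elim v

  rank<bound : ∀ {R v} (elim : LeafElimination R) → v ∈ R → rank elim v < rank-bound elim
  rank<bound {v = v} (done empty) v∈R = contradiction (v , v∈R) empty
  rank<bound {v = v} (remove x _ _ elim) v∈R with v ≟ x
  ... | yes _  = ≤-refl
  ... | no v≢x = m<n⇒m<1+n (rank<bound elim (x∈p∧x≢y⇒x∈p-y v∈R v≢x))

  rank-injective : ∀ {R u v} (elim : LeafElimination R) → u ∈ R → v ∈ R → rank elim u ≡ rank elim v → u ≡ v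
  rank-injective {u = u} (done empty) u∈R _ _ = contradiction (u , u∈R) empty
  rank-injective {u = u} {v} (remove x _ _ elim) u∈R v∈R eq with u ≟ x | v ≟ x
  ... | yes refl | yes refl = refl
  ... | yes _ | no v≢x = contradiction (≡.sym eq) (<⇒≢ (rank<bound elim (x∈p∧x≢y⇒x∈p-y v∈R v≢x)))
  ... | no u≢x | yes _ = contradiction eq (<⇒≢ (rank<bound elim (x∈p∧x≢y⇒x∈p-y u∈R u≢x)))
  ... | no u≢x | no v≢x = rank-injective elim (x∈p∧x≢y⇒x∈p-y u∈R u≢x) (x∈p∧x≢y⇒x∈p-y v∈R v≢x) eq

  -- Lower-ranked neighbours of `t` are still present when `t` is removed as a leaf, so there is at
  -- most one: the parent of `t` when the forest is rooted by rank.
  lower-neighbour-unique : ∀ {R t a b} (elim : LeafElimination R) → t ∈ R → a ∈ R → b ∈ R →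
    Adj G t a → Adj G t b → rank elim a < rank elim t → rank elim b < rank elim t → a ≡ b
  lower-neighbour-unique {t = t} (done empty) t∈R _ _ _ _ _ _ = contradiction (t , t∈R) empty
  lower-neighbour-unique {t = t} {a} {b} (remove x _ leaf elim) t∈R a∈R b∈R t~a t~b a<t b<t
    with t ≟ x | a ≟ x | b ≟ x
  ... | yes refl | _ | _ = leaf a b a∈R b∈R t~a t~b
  ... | no t≢x | yes _ | _ = contradiction (rank<bound elim (x∈p∧x≢y⇒x∈p-y t∈R t≢x)) (<-asym a<t)
  ... | no t≢x | no _ | yes _ = contradiction (rank<bound elim (x∈p∧x≢y⇒x∈p-y t∈R t≢x)) (<-asym b<t)
  ... | no t≢x | no a≢x | no b≢x = lower-neighbour-unique elim (x∈p∧x≢y⇒x∈p-y t∈R t≢x)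
    (x∈p∧x≢y⇒x∈p-y a∈R a≢x) (x∈p∧x≢y⇒x∈p-y b∈R b≢x) t~a t~b a<t b<t

-- Treewidth

module _ {n} {q : ℕ} (κ : Fin n → ℕ) (back : Fin n → List (Fin n)) (short : ∀ v → length (back v) < q) where

  private
    Proper : ℕ → (Fin n → Fin q) → Set
    Proper j c = ∀ w → κ w < j → ∀ u → u List.∈ back w → κ u < κ w → c w ≢ c u

    -- Only vertices with `κ` below `j` are constrained, so each round may recolour all the others
    -- at once; those at level `j` are then final.
    greedy-upto : (Fin n → Fin q) → ∀ j → ∃ (Proper j)
    greedy-upto c₀ zero = c₀ , λ w ()
    greedy-upto c₀ (suc j) with greedy-upto c₀ j
    ... | c , proper = c′ , proper′
      where
      fresh : ∀ v → ∃[ x ] (x List.∉ map c (back v))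
      fresh v = unused-colour (map c (back v)) (subst (_< q) (≡.sym (length-map c (back v))) (short v))

      c′ : Fin n → Fin q
      c′ v with κ v <? j
      ... | yes _ = c v
      ... | no _  = proj₁ (fresh v)

      c′≡c : ∀ v → κ v < j → c′ v ≡ c v
      c′≡c v v<j with κ v <? j
      ... | yes _  = refl
      ... | no v≮j = contradiction v<j v≮j

      proper′ : Proper (suc j) c′
      proper′ w w≤j u u∈back u<w eq with κ w <? j
      ... | yes w<j = proper w w<j u u∈back u<w (trans eq (c′≡c u (<-trans u<w w<j)))
      ... | no w≮j  = proj₂ (fresh w)
        (subst (List._∈ map c (back w)) (trans (≡.sym (c′≡c u (<-≤-trans u<w (s≤s⁻¹ w≤j)))) (≡.sym eq)) (∈-map⁺ c u∈back))

  greedy : ∀ bound → (∀ v → κ v < bound) → ∃[ c ] (∀ w u → u List.∈ back w → κ u < κ w → c w ≢ c u)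
  -- The initial colour is arbitrary; one exists because `short v` makes `q` positive.
  greedy bound bounded with greedy-upto (λ v → proj₁ (unused-colour [] (≤-<-trans z≤n (short v)))) bound
  ... | c , proper = c , λ w → proper w (bounded w)

module _ {n} (G : Graph n) (isolated-free : ∀ v → ∃[ u ] Adj G v u) {k} (D : TreeDecomp G k) where

  open TreeDecomp D

  private
    elim : LeafElimination T full
    elim = acyclic⇒elimination T full (acyclic-mono T _ (proj₂ isTree))

    ρ : Fin m → ℕ
    ρ = rank T elim

    lower-unique : ∀ {t a b} → Adj T t a → Adj T t b → ρ a < ρ t → ρ b < ρ t → a ≡ b
    lower-unique = lower-neighbour-unique T elim ∈⊤ ∈⊤ ∈⊤

    -- Walks inside `P` that go from child to parent in the tree rooted by `ρ`.
    data Descent (P : Fin m → Set) : Fin m → Fin m → Set where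
      stop : ∀ {s} → P s → Descent P s s
      down : ∀ {s s′ t} → P s → Adj T s s′ → ρ s′ < ρ s → Descent P s′ t → Descent P s t

    descent-≤ : ∀ {P s t} → Descent P s t → ρ t ≤ ρ s
    descent-≤ (stop _) = ≤-refl
    descent-≤ (down _ _ s′<s d) = ≤-trans (descent-≤ d) (<⇒≤ s′<s)

    -- A step up from `s` to `s′` cannot be the end, as `t` has least rank in `P`. The descent from
    -- `s′` therefore begins with its only lower neighbour, which is `s`, and the detour cancels.
    reach⇒descent : ∀ {P s t} → ReachWithin T P s t → (∀ y → P y → ρ t ≤ ρ y) → Descent P s t
    reach⇒descent (here Ps) _ = stop Ps
    reach⇒descent (step {s} {s′} Ps s~s′ r) least with <-cmp (ρ s′) (ρ s) | reach⇒descent r least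
    ... | tri< s′<s _ _ | d = down Ps s~s′ s′<s d
    ... | tri≈ _ eq _ | _ = contradiction (≡.sym (rank-injective T elim ∈⊤ ∈⊤ eq)) (adj⇒≢ T s~s′)
    ... | tri> _ _ s<s′ | stop _ = contradiction (least s Ps) (<⇒≱ s<s′)
    ... | tri> _ _ s<s′ | down _ s′~s″ s″<s′ d =
      subst (λ y → Descent _ y _) (lower-unique s′~s″ (adj-sym T s~s′) s″<s′ s<s′) d

    -- Both descents follow the same parent links from `s`, so the one ending lower passes through
    -- the end of the other.
    descent-through : ∀ {P Q s a b} → Descent P s a → Descent Q s b → ρ b ≤ ρ a → Q a
    descent-through (stop _) (stop Qs) _ = Qs
    descent-through (stop _) (down Qs _ _ _) _ = Qs
    descent-through (down _ _ s′<s d) (stop _) b≤a = contradiction (≤-<-trans (descent-≤ d) s′<s) (≤⇒≯ b≤a)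
    descent-through {Q = Q} (down _ s~s′ s′<s d) (down _ s~s″ s″<s e) b≤a
      with refl ← lower-unique s~s′ s~s″ s′<s s″<s = descent-through d e b≤a

    highest : ∀ v → ∃[ t ] (v ∈ bag t × (∀ s → v ∈ bag s → ρ t ≤ ρ s))
    highest v = argmin ρ (λ t → v ∈? bag t) (covV v)

    top : Fin n → Fin m
    top v = proj₁ (highest v)

    -- The descent from the common bag `s` to `top u` stays among the bags of `u` and passes through
    -- `top w`.
    share-bag : ∀ {u w s} → u ∈ bag s → w ∈ bag s → ρ (top u) ≤ ρ (top w) → u ∈ bag (top w)
    share-bag {u} {w} {s} u∈s w∈s = descent-through (descend w w∈s) (descend u u∈s)
      where
      descend : ∀ v → v ∈ bag s → Descent (λ t → v ∈ bag t) s (top v)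
      descend v v∈s with highest v
      ... | t , v∈t , least = reach⇒descent (coherent v s t v∈s v∈t) least

    -- The lexicographic order on pairs of `ρ (top v)` and `toℕ v`, packed into one number; `toℕ v`
    -- only breaks ties.
    κ : Fin n → ℕ
    κ v = ρ (top v) * n + toℕ v

    ρ<⇒κ< : ∀ u v → ρ (top u) < ρ (top v) → κ u < κ v
    ρ<⇒κ< u v lt = begin-strict
      ρ (top u) * n + toℕ u <⟨ +-monoʳ-< (ρ (top u) * n) (toℕ<n u) ⟩
      ρ (top u) * n + n     ≡⟨ +-comm (ρ (top u) * n) n ⟩
      suc (ρ (top u)) * n   ≤⟨ *-monoˡ-≤ n lt ⟩
      ρ (top v) * n         ≤⟨ m≤m+n _ (toℕ v) ⟩
      κ v ∎
      where open ≤-Reasoning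

    κ<⇒ρ≤ : ∀ {u v} → κ u < κ v → ρ (top u) ≤ ρ (top v)
    κ<⇒ρ≤ {u} {v} lt = ≮⇒≥ (λ gt → <-asym lt (ρ<⇒κ< v u gt))

    κ-injective : ∀ {u v} → κ u ≡ κ v → u ≡ v
    κ-injective {u} {v} eq with <-cmp (ρ (top u)) (ρ (top v))
    ... | tri< lt _ _ = contradiction eq (<⇒≢ (ρ<⇒κ< u v lt))
    ... | tri> _ _ gt = contradiction (≡.sym eq) (<⇒≢ (ρ<⇒κ< v u gt))
    ... | tri≈ _ same _ = toℕ-injective (+-cancelˡ-≡ (ρ (top v) * n) _ _
      (subst (λ r → r * n + toℕ u ≡ κ v) same eq))

    κ-bound : ∀ v → κ v < suc (rank-bound T elim) * n
    κ-bound v = begin-strict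
      ρ (top v) * n + toℕ v          <⟨ +-monoʳ-< (ρ (top v) * n) (toℕ<n v) ⟩
      ρ (top v) * n + n              ≡⟨ +-comm (ρ (top v) * n) n ⟩
      suc (ρ (top v)) * n            ≤⟨ *-monoˡ-≤ n (m≤n⇒m≤1+n (rank<bound T elim (∈⊤ {x = top v}))) ⟩
      suc (rank-bound T elim) * n    ∎
      where open ≤-Reasoning

    first : ∀ v → ∃[ u ] (Adj G v u × (∀ w → Adj G v w → κ u ≤ κ w))
    first v = argmin κ (adj? G v) (isolated-free v)

    f : Fin n → Fin n
    f v = proj₁ (first v)

    earlier-bag : ∀ {u w s} → u ∈ bag s → w ∈ bag s → κ u < κ w → u ∈ bag (top w) - w
    earlier-bag u∈s w∈s u<w =
      x∈p∧x≢y⇒x∈p-y (share-bag u∈s w∈s (κ<⇒ρ≤ u<w)) (λ { refl → <-irrefl refl u<w })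

    earlier-neighbour : ∀ {u w} → Adj G u w → κ u < κ w → u ∈ bag (top w) - w
    earlier-neighbour {u} {w} u~w u<w =
      let s , u∈s , w∈s = covE u w u~w in earlier-bag u∈s w∈s u<w

    B back : Fin n → List (Fin n)
    B w    = elements (bag (top w) - w)
    back w = B w ++ map f (B w)

    -- A bag has at most `suc k` elements, and here `w` itself is taken out.
    B-short : ∀ w → length (B w) ≤ k
    B-short w = subst (_≤ k) (≡.sym (length-elements (bag (top w) - w)))
      (s≤s⁻¹ (≤-trans (x∈p⇒∣p-x∣<∣p∣ (proj₁ (proj₂ (highest w)))) (width (top w))))

    back-short : ∀ w → length (back w) < 2 * k + 1
    back-short w = begin-strict
      length (B w ++ map f (B w))         ≡⟨ length-++ (B w) ⟩
      length (B w) + length (map f (B w)) ≡⟨ cong (length (B w) +_) (length-map f (B w)) ⟩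
      length (B w) + length (B w)         ≤⟨ +-mono-≤ (B-short w) (B-short w) ⟩
      k + k                               ≡⟨ cong (k +_) (+-identityʳ k) ⟨
      2 * k                               <⟨ m<m+n (2 * k) (s≤s z≤n) ⟩
      2 * k + 1                           ∎
      where open ≤-Reasoning

    f∈back : ∀ {v w} → Adj G v w → κ (f v) < κ w → κ v < κ w ⊎ κ w < κ v → f v List.∈ back w
    f∈back {v} {w} v~w fv<w (inj₁ v<w) = ∈-++⁺ʳ (B w) (∈-map⁺ f (∈-elements (earlier-neighbour v~w v<w)))
    -- Both `w` and `f v` are earlier neighbours of `v`, so they meet in its topmost bag.
    f∈back {v} {w} v~w fv<w (inj₂ w<v) = ∈-++⁺ˡ (∈-elements (earlier-bag fv∈ w∈ fv<w))
      where
      w∈ : w ∈ bag (top v)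
      w∈ = p─q⊆p _ _ (earlier-neighbour (adj-sym G v~w) w<v)
      fv∈ : f v ∈ bag (top v)
      fv∈ = p─q⊆p _ _ (earlier-neighbour (adj-sym G (proj₁ (proj₂ (first v)))) (<-trans fv<w w<v))

  treewidth-bound : HasONCF G (2 * k + 1)
  treewidth-bound =
    let c , proper = greedy κ back back-short (suc (rank-bound T elim) * n) κ-bound in
    c , λ v → f v , proj₁ (proj₂ (first v)) , λ w v~w w≢fv →
      let fv<w = ≤∧≢⇒< (proj₂ (proj₂ (first v)) w v~w) (w≢fv ∘ ≡.sym ∘ κ-injective)
          cmp = ≢⇒<⊎> (adj⇒≢ G v~w ∘ κ-injective)
      in proper w (f v) (f∈back v~w fv<w cmp) fv<w

-- Colours named after the vertices of a set

module _ {n} (S : Subset n) {k : ℕ} where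

  -- A colour is the name of a vertex of `S` or one of `k` extra colours. Proofs can thus compare
  -- colours as vertices; `position` numbers them only at the end.
  InPalette : Fin n ⊎ Fin k → Set
  InPalette (inj₁ s) = s ∈ S
  InPalette (inj₂ _) = ⊤

  private
    position : ∀ x → InPalette x → Fin (length (elements S)) ⊎ Fin k
    position (inj₁ s) s∈S = inj₁ (index (∈-elements s∈S))
    position (inj₂ i) _   = inj₂ i

    position-injective : ∀ x y p q → position x p ≡ position y q → x ≡ y
    position-injective (inj₁ s) (inj₁ t) p q eq =
      cong inj₁ (index-injective (∈-elements p) (∈-elements q) (inj₁-injective eq))
    position-injective (inj₂ i) (inj₂ j) _ _ eq = cong inj₂ (inj₂-injective eq)

  palette⇒HasONCF : (G : Graph n) (c : Fin n → Fin n ⊎ Fin k) → (∀ v → InPalette (c v)) →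
    (∀ v → ConflictFreeAt G c v) → HasONCF G (∣ S ∣ + k)
  palette⇒HasONCF G c inPalette cf = subst (λ l → HasONCF G (l + k)) (length-elements S)
    (conflictFree⇒HasONCF G c (λ v → join l k (position (c v) (inPalette v))) reflects cf)
    where
    l = length (elements S)
    reflects : ∀ u v → join l k (position (c u) (inPalette u)) ≡ join l k (position (c v) (inPalette v)) → c u ≡ c v
    reflects u v eq = position-injective (c u) (c v) (inPalette u) (inPalette v)
      (trans (≡.sym (splitAt-join l k _)) (trans (cong (splitAt l) eq) (splitAt-join l k _)))

preferred-neighbour : ∀ {n} (G : Graph n) → (∀ v → ∃[ u ] Adj G v u) → {P : Fin n → Set} → Decidable P →
  ∀ v → ∃[ u ] (Adj G v u × ((∃[ x ] (Adj G v x × P x)) → P u))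
preferred-neighbour G nb P? v with any? (λ x → adj? G v x ×-dec P? x)
... | yes (x , v~x , Px) = x , v~x , const Px
... | no none = let u , v~u = nb v in u , v~u , λ found → contradiction found none

-- Lending the names of lonely vertices to their witnesses

module NamedColouring {n} (G : Graph n) (S : Subset n) (f : Fin n → Fin n) (f-adj : ∀ v → Adj G v (f v)) where

  Lonely : Fin n → Set
  Lonely s = s ∈ S × ¬ (∃[ u ] (Adj G s u × u ∈ S))

  private
    attached? : ∀ s → Dec (∃[ u ] (Adj G s u × u ∈ S))
    attached? s = any? λ u → adj? G s u ×-dec (u ∈? S)

  lonely? : Decidable Lonely
  lonely? s = (s ∈? S) ×-dec ¬? (attached? s)

  attached : ∀ {s} → s ∈ S → ¬ Lonely s → ∃[ u ] (Adj G s u × u ∈ S)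
  attached {s} s∈S ¬lonely = decidable-stable (attached? s) (λ ¬att → ¬lonely (s∈S , ¬att))

  adj⇒¬lonely : ∀ {s u} → Adj G s u → u ∈ S → ¬ Lonely s
  adj⇒¬lonely s~u u∈S (_ , ¬att) = ¬att (_ , s~u , u∈S)

  lonely-neighbour : ∀ {s u} → Lonely s → Adj G s u → u ∉ S
  lonely-neighbour (_ , ¬att) s~u u∈S = ¬att (_ , s~u , u∈S)

  private
    Owner : Fin n → Fin n → Set
    Owner x s = Lonely s × f s ≡ x

    owner? : ∀ x → Dec (∃ (Owner x))
    owner? x = any? λ s → lonely? s ×-dec (f s ≟ x)

  -- Several lonely vertices may share the value x of f; x is named after the one that owner? finds.
  Named : Fin n → Fin n → Set
  Named x s = ∃[ o ] (owner? x ≡ yes (s , o))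

  named⇒lonely : ∀ {x s} → Named x s → Lonely s
  named⇒lonely ((lonely , _) , _) = lonely

  named⇒f : ∀ {x s} → Named x s → f s ≡ x
  named⇒f ((_ , fs≡x) , _) = fs≡x

  named-injective : ∀ {x y s} → Named x s → Named y s → x ≡ y
  named-injective a b = trans (≡.sym (named⇒f a)) (named⇒f b)

  named-functional : ∀ {x s t} → Named x s → Named x t → s ≡ t
  named-functional (_ , p) (_ , q) with refl ← trans (≡.sym p) q = refl

  lonely⇒named : ∀ {s} → Lonely s → ∃ (Named (f s))
  lonely⇒named {s} lonely with owner? (f s)
  ... | yes (t , o) = t , o , refl
  ... | no none = contradiction (s , lonely , refl) none

  -- `h` colours the vertices of `S`, and `base` the unnamed ones outside. By `h-name`, `h` may
  -- withhold a vertex's name but never gives it to another vertex.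
  module Colour {k} (h base : Fin n → Fin n ⊎ Fin k) (h-name : ∀ {w s} → h w ≡ inj₁ s → w ≡ s) where

    colour : Fin n → Fin n ⊎ Fin k
    colour v with v ∈? S | owner? v
    ... | yes _ | _           = h v
    ... | no _  | yes (s , _) = inj₁ s
    ... | no _  | no _        = base v

    -- A view of the case split in `colour` that keeps the resulting equation at hand.
    data Kind (v : Fin n) : Set where
      inner : v ∈ S → colour v ≡ h v → Kind v
      named : v ∉ S → ∀ s → Named v s → colour v ≡ inj₁ s → Kind v
      plain : v ∉ S → (∀ s → ¬ Named v s) → colour v ≡ base v → Kind v

    kind : ∀ v → Kind v
    kind v with v ∈? S in eq₁ | owner? v in eq₂
    ... | yes v∈S | _ = inner v∈S (colour-≡ eq₁)
      where
      colour-≡ : ∀ {p} → (v ∈? S) ≡ yes p → colour v ≡ h v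
      colour-≡ eq rewrite eq = refl
    ... | no v∉S | yes (s , o) = named v∉S s (o , eq₂) (colour-≡ eq₁ eq₂)
      where
      colour-≡ : ∀ {p} → (v ∈? S) ≡ no p → owner? v ≡ yes (s , o) → colour v ≡ inj₁ s
      colour-≡ eq eq′ rewrite eq | eq′ = refl
    ... | no v∉S | no none = plain v∉S (λ s (o , _) → none (s , o)) (colour-≡ eq₁ eq₂)
      where
      colour-≡ : ∀ {p q} → (v ∈? S) ≡ no p → owner? v ≡ no q → colour v ≡ base v
      colour-≡ eq eq′ rewrite eq | eq′ = refl

    colour-inner : ∀ {v} → v ∈ S → colour v ≡ h v
    colour-inner {v} v∈S with kind v
    ... | inner _ eq     = eq
    ... | named v∉S _ _ _ = contradiction v∈S v∉S
    ... | plain v∉S _ _  = contradiction v∈S v∉S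

    colour-named : ∀ {v s} → v ∉ S → Named v s → colour v ≡ inj₁ s
    colour-named {v} v∉S v-s with kind v
    ... | inner v∈S _ = contradiction v∈S v∉S
    ... | named _ t v-t eq = trans eq (cong inj₁ (named-functional v-t v-s))
    ... | plain _ none _ = contradiction v-s (none _)

    colour-inPalette : (∀ {v} → v ∈ S → InPalette S (h v)) → (∀ v → InPalette S (base v)) → ∀ v → InPalette S (colour v)
    colour-inPalette h-in base-in v with kind v
    ... | inner v∈S eq = subst (InPalette S) (≡.sym eq) (h-in v∈S)
    ... | named _ s v-s eq = subst (InPalette S) (≡.sym eq) (proj₁ (named⇒lonely v-s))
    ... | plain _ _ eq = subst (InPalette S) (≡.sym eq) (base-in v)

    -- No other outside vertex is named `s`, so only `s` itself or a `base` colour could repeat the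
    -- colour of `x`.
    at-named-neighbour : ∀ {v x s} → Adj G v x → x ∉ S → Named x s →
      (Adj G v s → h s ≢ inj₁ s) → (∀ w → Adj G v w → base w ≢ inj₁ s) → ConflictFreeAt G colour v
    at-named-neighbour {v} {x} {s} v~x x∉S x-s h≢ base≢ = x , v~x , unique
      where
      unique : ∀ w → Adj G v w → colour w ≡ colour x → w ≡ x
      unique w v~w eq with kind w | trans eq (colour-named x∉S x-s)
      ... | inner _ eq′ | eq″ with refl ← h-name (trans (≡.sym eq′) eq″) =
        contradiction (trans (≡.sym eq′) eq″) (h≢ v~w)
      ... | named _ t w-t eq′ | eq″ with refl ← trans (≡.sym eq′) eq″ = named-injective w-t x-s
      ... | plain _ _ eq′ | eq″ = contradiction (trans (≡.sym eq′) eq″) (base≢ w v~w)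

    -- `f s` may bear the name of another lonely `r`, but `r` lies in `S` and so is not adjacent to
    -- `s`.
    at-lonely : ∀ {s} → Lonely s → (∀ r → Named (f s) r → ∀ w → base w ≢ inj₁ r) → ConflictFreeAt G colour s
    at-lonely {s} lonely base≢ =
      let r , fs-r = lonely⇒named lonely in
      at-named-neighbour (f-adj s) (lonely-neighbour lonely (f-adj s)) fs-r
        (λ s~r → contradiction (proj₁ (named⇒lonely fs-r)) (lonely-neighbour lonely s~r))
        (λ w _ → base≢ r fs-r w)

    -- Having the neighbour `v` in `S`, the vertex `s` is not lonely, so its name is not lent to any
    -- outside vertex.
    at-inner-neighbour : ∀ {v s} → v ∈ S → s ∈ S → Adj G v s → h s ≡ inj₁ s →
      (∀ w → w ∉ S → Adj G v w → base w ≢ inj₁ s) → ConflictFreeAt G colour v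
    at-inner-neighbour {v} {s} v∈S s∈S v~s hs base≢ = s , v~s , unique
      where
      unique : ∀ w → Adj G v w → colour w ≡ colour s → w ≡ s
      unique w v~w eq with kind w | trans eq (trans (colour-inner s∈S) hs)
      ... | inner _ eq′ | eq″ = h-name (trans (≡.sym eq′) eq″)
      ... | named _ t w-t eq′ | eq″ with refl ← trans (≡.sym eq′) eq″ =
        contradiction (named⇒lonely w-t) (adj⇒¬lonely (adj-sym G v~s) v∈S)
      ... | plain w∉S _ eq′ | eq″ = contradiction (trans (≡.sym eq′) eq″) (base≢ w w∉S v~w)

    at-outer : ∀ {v} → (∀ {u} → Adj G v u → u ∈ S × h u ≡ inj₁ u) → ConflictFreeAt G colour v
    at-outer {v} all-inner = f v , f-adj v , λ w v~w eq →
      let fv∈S , h-fv = all-inner (f-adj v) in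
      h-name (trans (≡.sym (colour-inner (proj₁ (all-inner v~w)))) (trans eq (trans (colour-inner fv∈S) h-fv)))

    at-plain-neighbour : ∀ {v x} → Adj G v x → x ∉ S → (∀ s → ¬ Named x s) →
      (∀ w → w ∈ S → Adj G v w → h w ≢ base x) → (∀ w s → Named w s → inj₁ s ≢ base x) →
      (∀ w → w ∉ S → Adj G v w → base w ≡ base x → w ≡ x) → ConflictFreeAt G colour v
    at-plain-neighbour {v} {x} v~x x∉S none h≢ named≢ base-unique = x , v~x , unique
      where
      colour-x : colour x ≡ base x
      colour-x with kind x
      ... | inner x∈S _ = contradiction x∈S x∉S
      ... | named _ s x-s _ = contradiction x-s (none s)
      ... | plain _ _ eq = eq
      unique : ∀ w → Adj G v w → colour w ≡ colour x → w ≡ x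
      unique w v~w eq with kind w | trans eq colour-x
      ... | inner w∈S eq′ | eq″ = contradiction (trans (≡.sym eq′) eq″) (h≢ w w∈S v~w)
      ... | named _ s w-s eq′ | eq″ = contradiction (trans (≡.sym eq′) eq″) (named≢ w s w-s)
      ... | plain w∉S _ eq′ | eq″ = base-unique w w∉S v~w (trans (≡.sym eq′) eq″)

-- Feedback vertex sets

module _ {n} (G : Graph n) (nb : ∀ v → ∃[ u ] Adj G v u) (S : Subset n) where

  private
    Surrounded : Fin n → Set
    Surrounded x = ∀ u → Adj G x u → u ∈ S

    surrounded? : Decidable Surrounded
    surrounded? x = all? λ u → adj? G x u →-dec (u ∈? S)

    choice : ∀ v → ∃[ u ] (Adj G v u × ((∃[ x ] (Adj G v x × Surrounded x)) → Surrounded u))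
    choice = preferred-neighbour G nb surrounded?

    f : Fin n → Fin n
    f v = proj₁ (choice v)

    f-surrounded : ∀ {v x} → Adj G v x → Surrounded x → Surrounded (f v)
    f-surrounded {v} v~x x-surr = proj₂ (proj₂ (choice v)) (_ , v~x , x-surr)

    open NamedColouring G S f (λ v → proj₁ (proj₂ (choice v)))

    -- A lonely s without surrounded neighbour gives its name away: no vertex needs s as its witness.
    Anonymous : Fin n → Set
    Anonymous s = Lonely s × ¬ Surrounded (f s)

    anonymous? : Decidable Anonymous
    anonymous? s = lonely? s ×-dec ¬? (surrounded? (f s))

    h : Fin n → Fin n ⊎ Fin 3
    h s with anonymous? s
    ... | yes _ = inj₂ (suc (suc zero))
    ... | no _  = inj₁ s

    h-proper : ∀ {s} → ¬ Anonymous s → h s ≡ inj₁ s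
    h-proper {s} ¬anon with anonymous? s
    ... | yes anon = contradiction anon ¬anon
    ... | no _     = refl

    h-anonymous : ∀ {s} → Anonymous s → h s ≢ inj₁ s
    h-anonymous {s} anon with anonymous? s
    ... | yes _    = λ ()
    ... | no ¬anon = contradiction anon ¬anon

    h-name : ∀ {w s} → h w ≡ inj₁ s → w ≡ s
    h-name {w} eq with no _ ← anonymous? w = inj₁-injective eq

    shade : Bool → Fin n ⊎ Fin 3
    shade true  = inj₂ zero
    shade false = inj₂ (suc zero)

    shade-injective : ∀ a b → shade a ≡ shade b → a ≡ b
    shade-injective true  true  _ = refl
    shade-injective false false _ = refl

    shade≢inj₁ : ∀ b {s} → shade b ≢ inj₁ s
    shade≢inj₁ true  ()
    shade≢inj₁ false ()

    h≢shade : ∀ w b → h w ≢ shade b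
    h≢shade w b eq with anonymous? w
    h≢shade w true  () | yes _
    h≢shade w false () | yes _
    h≢shade w b eq | no _ = shade≢inj₁ b (≡.sym eq)

    h-inPalette : ∀ {v} → v ∈ S → InPalette S (h v)
    h-inPalette {v} v∈S with anonymous? v
    ... | yes _ = tt
    ... | no _  = v∈S

    shade-inPalette : ∀ b → InPalette S (shade b)
    shade-inPalette true  = tt
    shade-inPalette false = tt

  fvs-bound : IsFVS G S → HasONCF G (∣ S ∣ + 3)
  fvs-bound acyclic = palette⇒HasONCF S G colour (colour-inPalette h-inPalette (λ v → shade-inPalette (c v))) cf
    where
    elim : LeafElimination G (∁ S)
    elim = acyclic⇒elimination G (∁ S) (acyclic-mono G x∈∁p⇒x∉p acyclic)

    c : Fin n → Bool
    c = proj₁ (forest-colouring G elim)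

    open Colour h (shade ∘ c) h-name

    cf-inner : ∀ v → v ∈ S → Dec (Lonely v) → ConflictFreeAt G colour v
    cf-inner v v∈S (yes lonely) = at-lonely lonely (λ _ _ w → shade≢inj₁ (c w))
    cf-inner v v∈S (no ¬lonely) =
      let s , v~s , s∈S = attached v∈S ¬lonely in
      at-inner-neighbour v∈S s∈S v~s (h-proper (adj⇒¬lonely (adj-sym G v~s) v∈S ∘ proj₁)) (λ w _ _ → shade≢inj₁ (c w))

    cf-outer : ∀ v → v ∉ S → Dec (Surrounded v) → ConflictFreeAt G colour v
    -- `v` is a surrounded neighbour of each such `u`, so `f u` is surrounded and `u` keeps its
    -- name.
    cf-outer v v∉S (yes surr) = at-outer λ {u} v~u →
      surr u v~u , h-proper λ (_ , ¬surr) → ¬surr (f-surrounded (adj-sym G v~u) surr)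
    cf-outer v v∉S (no ¬surr) with any? (λ u → (u ∈? ∁ S) ×-dec adj? G v u)
    ... | no none = contradiction
      (λ u v~u → decidable-stable (u ∈? S) (λ u∉S → none (u , x∉p⇒x∈∁p u∉S , v~u))) ¬surr
    ... | yes nbr with proj₂ (forest-colouring G elim) v (x∉p⇒x∈∁p v∉S) nbr
    ... | p , p∈∁S , v~p , p-unique with kind p
    ... | inner p∈S _ = contradiction p∈S (x∈∁p⇒x∉p p∈∁S)
    -- Here `p` is `f s` and has the neighbour `v` outside `S`; hence `s` is anonymous and does not
    -- repeat the colour of `p`.
    ... | named p∉S s p-s _ = at-named-neighbour v~p p∉S p-s
      (λ _ → h-anonymous (named⇒lonely p-s , λ surr → v∉S (subst Surrounded (named⇒f p-s) surr v (adj-sym G v~p))))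
      (λ w _ → shade≢inj₁ (c w))
    ... | plain p∉S none _ = at-plain-neighbour v~p p∉S none
      (λ w _ _ → h≢shade w (c p)) (λ _ _ _ → shade≢inj₁ (c p) ∘ ≡.sym)
      (λ w w∉S v~w → p-unique w (x∉p⇒x∈∁p w∉S) v~w ∘ shade-injective (c w) (c p))

    cf : ∀ v → ConflictFreeAt G colour v
    cf v with v ∈? S
    ... | yes v∈S = cf-inner v v∈S (lonely? v)
    ... | no v∉S  = cf-outer v v∉S (surrounded? v)

-- Vertex covers

module _ {n} (G : Graph n) (nb : ∀ v → ∃[ u ] Adj G v u) (S : Subset n) (cover : IsVertexCover G S) where

  private
    outer-neighbour : ∀ {v u} → v ∉ S → Adj G v u → u ∈ S
    outer-neighbour v∉S v~u with cover _ _ v~u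
    ... | inj₁ v∈S = contradiction v∈S v∉S
    ... | inj₂ u∈S = u∈S

  vc-bound : HasONCF G (∣ S ∣ + 1)
  vc-bound = palette⇒HasONCF S G colour (colour-inPalette id (λ _ → tt)) cf
    where
    open NamedColouring G S (λ v → proj₁ (nb v)) (λ v → proj₂ (nb v))
    open Colour {1} inj₁ (λ _ → inj₂ zero) inj₁-injective

    cf : ∀ v → ConflictFreeAt G colour v
    cf v with v ∈? S | lonely? v
    ... | no v∉S  | _ = at-outer λ v~u → outer-neighbour v∉S v~u , refl
    ... | yes v∈S | yes lonely = at-lonely lonely λ _ _ _ ()
    ... | yes v∈S | no ¬lonely =
      let s , v~s , s∈S = attached v∈S ¬lonely in at-inner-neighbour v∈S s∈S v~s refl λ _ _ _ ()

  module ReusingNames (f : Fin n → Fin n) (f-adj : ∀ v → Adj G v (f v)) where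

    open NamedColouring G S f f-adj public

    module Base (base : Fin n → Fin n) (base∈S : ∀ v → base v ∈ S) where

      open Colour {0} inj₁ (inj₁ ∘ base) inj₁-injective public

      -- Vertices outside `S` see only vertices of `S` under their own names, so they are
      -- conflict-free for any `base`.
      inner⇒HasONCF : (∀ v → v ∈ S → ConflictFreeAt G colour v) → HasONCF G ∣ S ∣
      inner⇒HasONCF cf-inner = subst (HasONCF G) (+-identityʳ ∣ S ∣)
        (palette⇒HasONCF S G colour (colour-inPalette id base∈S) cf)
        where
        cf : ∀ v → ConflictFreeAt G colour v
        cf v with v ∈? S
        ... | yes v∈S = cf-inner v v∈S
        ... | no v∉S  = at-outer λ v~u → outer-neighbour v∉S v~u , refl

    -- Lent names belong to lonely vertices and so differ from `a`; the attached vertices need a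
    -- witness in `S` other than `a`.
    spare-attached-name : ∀ a → a ∈ S → ¬ Lonely a →
      (∀ v → v ∈ S → ¬ Lonely v → ∃[ s ] (s ∈ S × Adj G v s × s ≢ a)) → HasONCF G ∣ S ∣
    spare-attached-name a a∈S ¬lonely-a other = inner⇒HasONCF cf
      where
      open Base (const a) (const a∈S)
      cf : ∀ v → v ∈ S → ConflictFreeAt G colour v
      cf v v∈S with lonely? v
      ... | yes lonely = at-lonely lonely λ { r fv-r w refl → ¬lonely-a (named⇒lonely fv-r) }
      ... | no ¬lonely =
        let s , s∈S , v~s , s≢a = other v v∈S ¬lonely in
        at-inner-neighbour v∈S s∈S v~s refl (λ _ _ _ → s≢a ∘ ≡.sym ∘ inj₁-injective)

    -- The inner witnesses of attached vertices are attached themselves, hence never `a`.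
    spare-lonely-name : ∀ a → Lonely a → (∀ x → ¬ Named x a) → HasONCF G ∣ S ∣
    spare-lonely-name a lonely-a unused = inner⇒HasONCF cf
      where
      open Base (const a) (const (proj₁ lonely-a))
      cf : ∀ v → v ∈ S → ConflictFreeAt G colour v
      cf v v∈S with lonely? v
      ... | yes lonely = at-lonely lonely λ { r fv-r w refl → unused _ fv-r }
      ... | no ¬lonely =
        let s , v~s , s∈S = attached v∈S ¬lonely in
        at-inner-neighbour v∈S s∈S v~s refl
          λ { _ _ _ refl → adj⇒¬lonely (adj-sym G v~s) v∈S lonely-a }

  -- If some neighbour `x` of `b` in `S` has no neighbour in `S` but `b`, the name of `x` can be
  -- spared, since `b` has another witness. Otherwise every neighbour of `b` in `S` can do without
  -- `b`.
  branching⇒HasONCF : ∀ {b} → b ∈ S → Branching G S b → HasONCF G ∣ S ∣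
  branching⇒HasONCF {b} b∈S (p , q , p∈S , q∈S , b~p , b~q , p≢q)
    with any? (λ x → (x ∈? S) ×-dec adj? G b x ×-dec ¬? (any? λ y → (y ∈? S) ×-dec adj? G x y ×-dec ¬? (y ≟ b)))
  ... | yes (x , x∈S , b~x , pendant) = spare-attached-name x x∈S (adj⇒¬lonely (adj-sym G b~x) b∈S) other
    where
    open ReusingNames (λ v → proj₁ (nb v)) (λ v → proj₂ (nb v))
    other-than-x : ∃[ s ] (s ∈ S × Adj G b s × s ≢ x)
    other-than-x with p ≟ x
    ... | no p≢x = p , p∈S , b~p , p≢x
    ... | yes refl = q , q∈S , b~q , p≢q ∘ ≡.sym
    other : ∀ v → v ∈ S → ¬ Lonely v → ∃[ s ] (s ∈ S × Adj G v s × s ≢ x)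
    other v v∈S ¬lonely with attached v∈S ¬lonely
    ... | u , v~u , u∈S with u ≟ x
    ...   | no u≢x = u , u∈S , v~u , u≢x
    ...   | yes refl with v ≟ b
    ...     | yes refl = other-than-x
    ...     | no v≢b = contradiction (v , v∈S , adj-sym G v~u , v≢b) pendant
  ... | no none = spare-attached-name b b∈S (adj⇒¬lonely b~p p∈S) other
    where
    open ReusingNames (λ v → proj₁ (nb v)) (λ v → proj₂ (nb v))
    other : ∀ v → v ∈ S → ¬ Lonely v → ∃[ s ] (s ∈ S × Adj G v s × s ≢ b)
    other v v∈S ¬lonely with attached v∈S ¬lonely
    ... | u , v~u , u∈S with u ≟ b
    ...   | no u≢b = u , u∈S , v~u , u≢b
    ...   | yes refl = decidable-stable
      (any? λ y → (y ∈? S) ×-dec adj? G v y ×-dec ¬? (y ≟ b))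
      (λ pendant → none (v , v∈S , adj-sym G v~u , pendant))

  module Sharing (z : Fin n) where

    private
      choice : ∀ v → ∃[ u ] (Adj G v u × ((∃[ x ] (Adj G v x × x ≡ z)) → u ≡ z))
      choice = preferred-neighbour G nb (_≟ z)

    open ReusingNames (λ v → proj₁ (choice v)) (λ v → proj₁ (proj₂ (choice v))) public

    named-z : ∀ {s} → Lonely s → Adj G s z → ∃ (Named z)
    named-z {s} lonely s~z = subst (λ x → ∃ (Named x)) (proj₂ (proj₂ (choice s)) (z , s~z , refl)) (lonely⇒named lonely)

    -- `f` prefers `z`, so both vertices choose `z`; as `z` bears only one name, that of `s` or that
    -- of `t` is lent to nobody.
    two-lonely⇒HasONCF : ∀ {s t} → Lonely s → Lonely t → s ≢ t → Adj G s z → Adj G t z → HasONCF G ∣ S ∣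
    two-lonely⇒HasONCF {s} {t} lonely-s lonely-t s≢t s~z t~z = spare (named-z lonely-s s~z)
      where
      unused : ∀ {a r} → Adj G a z → Named z r → r ≢ a → ∀ x → ¬ Named x a
      unused {a} a~z z-r r≢a x x-a = r≢a (named-functional z-r
        (subst (λ y → Named y a) (trans (≡.sym (named⇒f x-a)) (proj₂ (proj₂ (choice a)) (z , a~z , refl))) x-a))
      spare : ∃ (Named z) → HasONCF G ∣ S ∣
      spare (r , z-r) with r ≟ s
      ... | no r≢s   = spare-lonely-name s lonely-s (unused s~z z-r r≢s)
      ... | yes refl = spare-lonely-name t lonely-t (unused t~z z-r s≢t)

    -- Bearing the name of a lonely vertex, `z` can replace `a` as the witness of `t`. By `matching`
    -- only `t` needs the name of `a`, which is thereby spared.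
    lonely-attached⇒HasONCF : (∀ {v} → v ∈ S → AtMostOneNeighbour G S v) →
      ∀ {s t a} → Lonely s → Adj G s z → t ∈ S → Adj G t z → a ∈ S → Adj G t a → HasONCF G ∣ S ∣
    lonely-attached⇒HasONCF matching {s} {t} {a} lonely-s s~z t∈S t~z a∈S t~a = inner⇒HasONCF cf
      where
      open Base (const a) (const a∈S)
      ¬lonely-a : ¬ Lonely a
      ¬lonely-a = adj⇒¬lonely (adj-sym G t~a) t∈S
      at-t : ConflictFreeAt G colour t
      at-t with named-z lonely-s s~z
      ... | r , z-r = at-named-neighbour t~z (lonely-neighbour lonely-s s~z) z-r
        (λ t~r _ → adj⇒¬lonely (adj-sym G t~r) t∈S (named⇒lonely z-r))
        (λ { _ _ refl → ¬lonely-a (named⇒lonely z-r) })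
      cf : ∀ v → v ∈ S → ConflictFreeAt G colour v
      cf v v∈S with lonely? v | v ≟ t
      ... | yes lonely | _ = at-lonely lonely λ { r fv-r w refl → ¬lonely-a (named⇒lonely fv-r) }
      ... | no _ | yes refl = at-t
      ... | no ¬lonely | no v≢t =
        let u , v~u , u∈S = attached v∈S ¬lonely in
        at-inner-neighbour v∈S u∈S v~u refl
          λ { _ _ _ refl → v≢t (matching a∈S v t v∈S t∈S (adj-sym G v~u) (adj-sym G t~a)) }

  module _ (conn : Connected G) (matching : ∀ {v} → v ∈ S → AtMostOneNeighbour G S v) where

    private
      -- Loneliness does not depend on the chosen neighbours, so facts found here carry over to the
      -- choice made in `Sharing`.
      module Any = NamedColouring G S (λ v → proj₁ (nb v)) (λ v → proj₂ (nb v))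

    -- If `s` is adjacent to all other vertices, `S` contains only `s` and the graph is a star.
    -- Otherwise some walk leaves the closed neighbourhood of `s` along an edge from `z` to `t`; as
    -- `z` is outside `S`, the cover contains `t`.
    lonely⇒HasONCF : ¬ IsStar G → ∀ {s} → Any.Lonely s → HasONCF G ∣ S ∣
    lonely⇒HasONCF ¬star {s} lonely@(s∈S , _) with any? (λ y → ¬? (y ≟ s) ×-dec ¬? (adj? G s y))
    ... | no none = contradiction (s , star-adj , star-only) ¬star
      where
      star-adj : ∀ v → v ≢ s → Adj G s v
      star-adj v v≢s = decidable-stable (adj? G s v) (λ s≁v → none (v , v≢s , s≁v))
      only : ∀ {u} → u ∈ S → u ≡ s
      only {u} u∈S = decidable-stable (u ≟ s) (λ u≢s → Any.lonely-neighbour lonely (star-adj u u≢s) u∈S)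
      star-only : ∀ u v → Adj G u v → u ≡ s ⊎ v ≡ s
      star-only u v u~v = Sum.map only only (cover u v u~v)
    ... | yes (y , y≢s , s≁y)
      with exit-edge G {X = λ x → x ≡ s ⊎ Adj G s x} (λ x → (x ≟ s) ⊎-dec adj? G s x) (conn s y)
             (inj₁ refl) Sum.[ y≢s , s≁y ]
    ...   | z , t , z~t , inj₁ refl , outside-t = contradiction (inj₂ z~t) outside-t
    ...   | z , t , z~t , inj₂ s~z , outside-t = finish (Any.lonely? t)
      where
      open Sharing z
      t∈S : t ∈ S
      t∈S = outer-neighbour (Any.lonely-neighbour lonely s~z) z~t
      finish : Dec (Any.Lonely t) → HasONCF G ∣ S ∣
      finish (yes lonely-t) = two-lonely⇒HasONCF lonely lonely-t (λ { refl → outside-t (inj₁ refl) }) s~z (adj-sym G z~t)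
      finish (no ¬lonely-t) =
        let a , t~a , a∈S = Any.attached t∈S ¬lonely-t in
        lonely-attached⇒HasONCF matching lonely s~z t∈S (adj-sym G z~t) a∈S t~a

    -- Covers that induce a perfect matching

    module PerfectMatching (perfect : ∀ {v} → v ∈ S → ∃[ u ] (Adj G v u × u ∈ S)) where

      private
        choice : ∀ v → ∃[ u ] (Adj G v u × ((∃[ x ] (Adj G v x × x ∈ S)) → u ∈ S))
        choice = preferred-neighbour G nb (_∈? S)

        mate : Fin n → Fin n
        mate v = proj₁ (choice v)

        mate-adj : ∀ v → Adj G v (mate v)
        mate-adj v = proj₁ (proj₂ (choice v))

        mate∈S : ∀ {v} → v ∈ S → mate v ∈ S
        mate∈S {v} v∈S = proj₂ (proj₂ (choice v)) (perfect v∈S)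

        mate-unique : ∀ {v u} → v ∈ S → u ∈ S → Adj G v u → u ≡ mate v
        mate-unique v∈S u∈S v~u = matching v∈S _ _ u∈S (mate∈S v∈S) v~u (mate-adj _)

        mate-involutive : ∀ {v} → v ∈ S → mate (mate v) ≡ v
        mate-involutive v∈S = ≡.sym (mate-unique (mate∈S v∈S) v∈S (adj-sym G (mate-adj _)))

        mate≢ : ∀ v → mate v ≢ v
        mate≢ v = adj⇒≢ G (mate-adj v) ∘ ≡.sym

        open ReusingNames mate mate-adj

        unnamed : ∀ x s → ¬ Named x s
        unnamed x s x-s = proj₂ (named⇒lonely x-s) (perfect (proj₁ (named⇒lonely x-s)))

      -- Colour `z` with `t` and the rest outside with `mate t`. Then `t` has the witness `z`, and
      -- all others in `S` have their mates: the name `t` matters only to `mate t`, which does not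
      -- see `z`.
      separated-pair⇒HasONCF : ∀ {z t} → z ∉ S → t ∈ S → Adj G z t → ¬ Adj G z (mate t) → HasONCF G ∣ S ∣
      separated-pair⇒HasONCF {z} {t} z∉S t∈S z~t z≁t′ = inner⇒HasONCF cf
        where
        base : Fin n → Fin n
        base w with w ≟ z
        ... | yes _ = t
        ... | no _  = mate t

        base-z : base z ≡ t
        base-z with z ≟ z
        ... | yes _  = refl
        ... | no z≢z = contradiction refl z≢z

        base∈S : ∀ w → base w ∈ S
        base∈S w with w ≟ z
        ... | yes _ = t∈S
        ... | no _  = mate∈S t∈S

        base-t : ∀ w → base w ≡ t → w ≡ z
        base-t w eq with w ≟ z
        ... | yes w≡z = w≡z
        ... | no _    = contradiction eq (mate≢ t)

        base-cases : ∀ w → base w ≡ t ⊎ base w ≡ mate t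
        base-cases w with w ≟ z
        ... | yes _ = inj₁ refl
        ... | no _  = inj₂ refl

        open Base base base∈S

        cf : ∀ v → v ∈ S → ConflictFreeAt G colour v
        cf v v∈S with v ≟ t
        ... | yes refl = at-plain-neighbour (adj-sym G z~t) z∉S (unnamed z)
          (λ w _ t~w eq → adj⇒≢ G t~w (≡.sym (trans (inj₁-injective eq) base-z)))
          (λ w s w-s → contradiction w-s (unnamed w s))
          (λ w _ _ eq → base-t w (trans (inj₁-injective eq) base-z))
        ... | no v≢t = at-inner-neighbour v∈S (mate∈S v∈S) (mate-adj v) refl λ w w∉S v~w eq → clash w v~w (inj₁-injective eq) (base-cases w)
          where
          clash : ∀ w → Adj G v w → base w ≡ mate v → ¬ (base w ≡ t ⊎ base w ≡ mate t)
          clash w v~w eq (inj₂ eq′) = v≢t (trans (≡.sym (mate-involutive v∈S))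
            (trans (cong mate (trans (≡.sym eq) eq′)) (mate-involutive t∈S)))
          clash w v~w eq (inj₁ eq′) with refl ← base-t w eq′ =
            z≁t′ (subst (Adj G z) (trans (≡.sym (mate-involutive v∈S)) (cong mate (trans (≡.sym eq) eq′))) (adj-sym G v~w))

      -- Three colours suffice: `z`, alone in its colour, serves all of `S`, and `t`, alone in its
      -- own, serves everything outside.
      complete⇒HasONCF : (∀ {w t} → w ∉ S → t ∈ S → Adj G w t) →
        ∀ {z t u} → z ∉ S → t ∈ S → u ∈ S → u ≢ t → u ≢ mate t → HasONCF G ∣ S ∣
      complete⇒HasONCF complete {z} {t} {u} z∉S t∈S u∈S u≢t u≢t′ = subst (HasONCF G) (+-identityʳ ∣ S ∣)
        (palette⇒HasONCF S G (inj₁ ∘ colour) inPalette cf)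
        where
        colour : Fin n → Fin n
        colour v with v ≟ z | v ≟ t
        ... | yes _ | _     = u
        ... | no _  | yes _ = t
        ... | no _  | no _  = mate t

        inPalette : ∀ v → colour v ∈ S
        inPalette v with v ≟ z | v ≟ t
        ... | yes _ | _     = u∈S
        ... | no _  | yes _ = t∈S
        ... | no _  | no _  = mate∈S t∈S

        colour-z : colour z ≡ u
        colour-z with z ≟ z
        ... | yes _  = refl
        ... | no z≢z = contradiction refl z≢z

        colour-t : colour t ≡ t
        colour-t with t ≟ z | t ≟ t
        ... | yes refl | _     = contradiction t∈S z∉S
        ... | no _     | yes _ = refl
        ... | no _     | no t≢t = contradiction refl t≢t

        colour-u : ∀ v → colour v ≡ u → v ≡ z
        colour-u v eq with v ≟ z | v ≟ t
        ... | yes v≡z | _     = v≡z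
        ... | no _    | yes _ = contradiction (≡.sym eq) u≢t
        ... | no _    | no _  = contradiction (≡.sym eq) u≢t′

        colour⁻¹-t : ∀ v → colour v ≡ t → v ≡ t
        colour⁻¹-t v eq with v ≟ z | v ≟ t
        ... | yes _ | _       = contradiction eq u≢t
        ... | no _  | yes v≡t = v≡t
        ... | no _  | no _    = contradiction eq (mate≢ t)

        cf : ∀ v → ConflictFreeAt G {Fin n ⊎ Fin 0} (inj₁ ∘ colour) v
        cf v with v ∈? S
        ... | yes v∈S = z , adj-sym G (complete z∉S v∈S) , λ w _ eq → colour-u w (trans (inj₁-injective eq) colour-z)
        ... | no v∉S  = t , complete v∉S t∈S , λ w _ eq → colour⁻¹-t w (trans (inj₁-injective eq) colour-t)

      -- A cover with just one matched pair gives an edge-star. If nothing lies outside `S`, the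
      -- whole graph is a perfect matching, and connectedness rules out a second pair.
      complete-cover⇒HasONCF : ¬ IsEdgeStar G → (∀ {w t} → w ∉ S → t ∈ S → Adj G w t) →
        ∀ {t} → t ∈ S → HasONCF G ∣ S ∣
      complete-cover⇒HasONCF ¬edgeStar complete {t} t∈S
        with any? (λ u → (u ∈? S) ×-dec ¬? (u ≟ t) ×-dec ¬? (u ≟ mate t))
      ... | no none = contradiction (t , mate t , mate-adj t , edge-star) ¬edgeStar
        where
        ∈S⇒ : ∀ {x} → x ∈ S → x ≡ t ⊎ x ≡ mate t
        ∈S⇒ {x} x∈S = decidable-stable ((x ≟ t) ⊎-dec (x ≟ mate t))
          (λ neither → none (x , x∈S , neither ∘ inj₁ , neither ∘ inj₂))
        edge-star : ∀ w → w ≢ t → w ≢ mate t → ∀ x →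
          (Adj G w x → x ≡ t ⊎ x ≡ mate t) × (x ≡ t ⊎ x ≡ mate t → Adj G w x)
        edge-star w w≢t w≢t′ x = ∈S⇒ ∘ outer-neighbour w∉S ,
          λ { (inj₁ refl) → complete w∉S t∈S ; (inj₂ refl) → complete w∉S (mate∈S t∈S) }
          where
          w∉S : w ∉ S
          w∉S w∈S = Sum.[ w≢t , w≢t′ ] (∈S⇒ w∈S)
      ... | yes (u , u∈S , u≢t , u≢t′) with any? (λ z → ¬? (z ∈? S))
      ...   | yes (z , z∉S) = complete⇒HasONCF complete z∉S t∈S u∈S u≢t u≢t′
      ...   | no none
        with exit-edge G {X = λ x → x ≡ t ⊎ x ≡ mate t} (λ x → (x ≟ t) ⊎-dec (x ≟ mate t)) (conn t u)
               (inj₁ refl) Sum.[ u≢t , u≢t′ ]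
      ...     | p , q , p~q , p∈X , q∉X = contradiction (q∈X p∈X) q∉X
        where
        q∈S : q ∈ S
        q∈S = decidable-stable (q ∈? S) (λ q∉S → none (q , q∉S))
        q∈X : p ≡ t ⊎ p ≡ mate t → q ≡ t ⊎ q ≡ mate t
        q∈X (inj₁ refl) = inj₂ (mate-unique t∈S q∈S p~q)
        q∈X (inj₂ refl) = inj₁ (trans (mate-unique (mate∈S t∈S) q∈S p~q) (mate-involutive t∈S))

      module _ (balanced : ∀ {w t} → w ∉ S → t ∈ S → Adj G w t → Adj G w (mate t)) where

        -- `t` gets the witness `z`, coloured `t`, and `mate t` the witness `w`, coloured `u`. All
        -- others in `S` rely on their mates; the name `u` matters only to `mate u`, which by
        -- `balanced` is not adjacent to `w`.
        overlapping⇒HasONCF : ∀ {z w t u} → z ∉ S → w ∉ S → t ∈ S → u ∈ S →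
          Adj G z t → Adj G z u → Adj G w t → ¬ Adj G w u → HasONCF G ∣ S ∣
        overlapping⇒HasONCF {z} {w} {t} {u} z∉S w∉S t∈S u∈S z~t z~u w~t w≁u = inner⇒HasONCF cf
          where
          t′ = mate t

          data View (x : Fin n) : Fin n → Set where
            is-z  : x ≡ z → View x t
            is-w  : x ≡ w → View x u
            other : View x t′

          view : ∀ x → ∃ (View x)
          view x with x ≟ z | x ≟ w
          ... | yes x≡z | _       = t , is-z x≡z
          ... | no _    | yes x≡w = u , is-w x≡w
          ... | no _    | no _    = t′ , other

          base : Fin n → Fin n
          base x = proj₁ (view x)

          w≢z : w ≢ z
          w≢z refl = w≁u z~u

          base-z : base z ≡ t
          base-z with z ≟ z
          ... | yes _  = refl
          ... | no z≢z = contradiction refl z≢z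

          base-w : base w ≡ u
          base-w with w ≟ z | w ≟ w
          ... | yes w≡z | _      = contradiction w≡z w≢z
          ... | no _    | yes _  = refl
          ... | no _    | no w≢w = contradiction refl w≢w

          u≢t : u ≢ t
          u≢t refl = w≁u w~t

          u≢t′ : u ≢ t′
          u≢t′ u≡t′ = w≁u (subst (Adj G w) (≡.sym u≡t′) (balanced w∉S t∈S w~t))

          base∈S : ∀ x → base x ∈ S
          base∈S x with view x
          ... | _ , is-z _ = t∈S
          ... | _ , is-w _ = u∈S
          ... | _ , other  = mate∈S t∈S

          base-t : ∀ x → base x ≡ t → x ≡ z
          base-t x eq with view x
          ... | _ , is-z x≡z = x≡z
          ... | _ , is-w _   = contradiction eq u≢t
          ... | _ , other    = contradiction eq (mate≢ t)

          base-u : ∀ x → base x ≡ u → x ≡ w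
          base-u x eq with view x
          ... | _ , is-z _   = contradiction (≡.sym eq) u≢t
          ... | _ , is-w x≡w = x≡w
          ... | _ , other    = contradiction (≡.sym eq) u≢t′

          open Base base base∈S

          cf : ∀ v → v ∈ S → ConflictFreeAt G colour v
          cf v v∈S with v ≟ t | v ≟ t′
          ... | yes refl | _ = at-plain-neighbour (adj-sym G z~t) z∉S (unnamed z)
            (λ x _ t~x eq → adj⇒≢ G t~x (≡.sym (trans (inj₁-injective eq) base-z)))
            (λ x s x-s → contradiction x-s (unnamed x s))
            (λ x _ _ eq → base-t x (trans (inj₁-injective eq) base-z))
          ... | no _ | yes refl = at-plain-neighbour (adj-sym G (balanced w∉S t∈S w~t)) w∉S (unnamed w)
            (λ x x∈S t′~x eq → u≢t (trans (≡.sym (trans (inj₁-injective eq) base-w))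
              (trans (mate-unique (mate∈S t∈S) x∈S t′~x) (mate-involutive t∈S))))
            (λ x s x-s → contradiction x-s (unnamed x s))
            (λ x _ _ eq → base-u x (trans (inj₁-injective eq) base-w))
          ... | no v≢t | no v≢t′ = at-inner-neighbour v∈S (mate∈S v∈S) (mate-adj v) refl
            λ x _ v~x eq → clash x v~x (inj₁-injective eq)
            where
            clash : ∀ x → Adj G v x → base x ≢ mate v
            clash x v~x eq with view x
            ... | _ , is-z _    = v≢t′ (trans (≡.sym (mate-involutive v∈S)) (cong mate (≡.sym eq)))
            ... | _ , is-w refl = w≁u (subst (Adj G w) (≡.sym eq) (balanced w∉S v∈S (adj-sym G v~x)))
            ... | _ , other     = v≢t (trans (≡.sym (mate-involutive v∈S)) (trans (cong mate (≡.sym eq)) (mate-involutive t∈S)))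

        -- A walk from `t` to `u` leaves the ball of radius two around `w` along an edge from `p` to
        -- `q`. By `balanced`, mates of neighbours of `w` are neighbours of `w`, so `p` lies outside
        -- `S`; it shares the neighbour `s` with `w`, but not `q`.
        partial⇒HasONCF : ∀ {w t u} → w ∉ S → t ∈ S → u ∈ S → Adj G w t → ¬ Adj G w u → HasONCF G ∣ S ∣
        partial⇒HasONCF {w} {t} {u} w∉S t∈S u∈S w~t w≁u
          with exit-edge G {X = Near} near? (conn t u) (t , w~t , inj₁ refl) far-u
          where
          Near : Fin n → Set
          Near y = ∃[ s ] (Adj G w s × (y ≡ s ⊎ Adj G s y))
          near? : Decidable Near
          near? y = any? λ s → adj? G w s ×-dec ((y ≟ s) ⊎-dec adj? G s y)
          far-u : ¬ Near u
          far-u (s , w~s , inj₁ refl) = w≁u w~s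
          far-u (s , w~s , inj₂ s~u) = w≁u (subst (Adj G w) (≡.sym (mate-unique s∈S u∈S s~u)) (balanced w∉S s∈S w~s))
            where s∈S = outer-neighbour w∉S w~s
        ... | p , q , p~q , (s , w~s , inj₁ refl) , far-q = contradiction (p , w~s , inj₂ p~q) far-q
        ... | p , q , p~q , (s , w~s , inj₂ s~p) , far-q with p ∈? S
        ...   | yes p∈S = contradiction (p , subst (Adj G w) (≡.sym (mate-unique s∈S p∈S s~p)) (balanced w∉S s∈S w~s) , inj₂ p~q) far-q
          where s∈S = outer-neighbour w∉S w~s
        ...   | no p∉S = overlapping⇒HasONCF p∉S w∉S (outer-neighbour w∉S w~s) (outer-neighbour p∉S p~q)
          (adj-sym G s~p) p~q w~s (λ w~q → far-q (q , w~q , inj₁ refl))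

      perfect-matching⇒HasONCF : ¬ IsEdgeStar G → ∀ {t} → t ∈ S → HasONCF G ∣ S ∣
      perfect-matching⇒HasONCF ¬edgeStar t∈S
        with any? (λ z → any? λ t → ¬? (z ∈? S) ×-dec (t ∈? S) ×-dec adj? G z t ×-dec ¬? (adj? G z (mate t)))
      ... | yes (z , t , z∉S , t∈S , z~t , z≁t′) = separated-pair⇒HasONCF z∉S t∈S z~t z≁t′
      ... | no none = rest
        where
        balanced : ∀ {w t} → w ∉ S → t ∈ S → Adj G w t → Adj G w (mate t)
        balanced {w} {t} w∉S t∈S w~t = decidable-stable (adj? G w (mate t))
          (λ w≁t′ → none (w , t , w∉S , t∈S , w~t , w≁t′))
        rest : HasONCF G ∣ S ∣
        rest with any? (λ w → any? λ u → ¬? (w ∈? S) ×-dec (u ∈? S) ×-dec ¬? (adj? G w u))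
        ... | yes (w , u , w∉S , u∈S , w≁u) =
          let t , w~t = nb w in partial⇒HasONCF balanced w∉S (outer-neighbour w∉S w~t) u∈S w~t w≁u
        ... | no all-adjacent = complete-cover⇒HasONCF ¬edgeStar
          (λ {w} {u} w∉S u∈S → decidable-stable (adj? G w u) (λ w≁u → all-adjacent (w , u , w∉S , u∈S , w≁u))) t∈S

    matching⇒HasONCF : ¬ IsStar G → ¬ IsEdgeStar G → Fin n → HasONCF G ∣ S ∣
    matching⇒HasONCF ¬star ¬edgeStar v with any? Any.lonely?
    ... | yes (s , lonely) = lonely⇒HasONCF ¬star lonely
    ... | no none = Sum.[ perfect , perfect ] (cover _ _ (proj₂ (nb v)))
      where
      perfect : ∀ {t} → t ∈ S → HasONCF G ∣ S ∣
      perfect = PerfectMatching.perfect-matching⇒HasONCF (λ v∈S → Any.attached v∈S (λ lonely → none (_ , lonely))) ¬edgeStar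

  sharp-vc-bound : Connected G → ¬ IsStar G → ¬ IsEdgeStar G → Fin n → HasONCF G ∣ S ∣
  sharp-vc-bound conn ¬star ¬edgeStar v with any? (λ b → (b ∈? S) ×-dec branching? G S b)
  ... | yes (b , b∈S , branching) = branching⇒HasONCF b∈S branching
  ... | no none = matching⇒HasONCF conn
    (λ {x} x∈S a b a∈S b∈S x~a x~b → decidable-stable (a ≟ b)
      (λ a≢b → none (x , x∈S , a , b , a∈S , b∈S , x~a , x~b , a≢b)))
    ¬star ¬edgeStar v

-- Quantifying over all decompositions, feedback vertex sets and covers includes the optimal ones,
-- which yields the bounds in terms of the graph parameters.
theorem10 : ∀ {n} (G : Graph n) → 2 ≤ n → Connected G →
    ((k : ℕ) → TreeDecomp G k → HasONCF G (2 * k + 1))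
    × ((S : Subset n) → IsFVS G S → HasONCF G (∣ S ∣ + 3))
    × ((S : Subset n) → IsVertexCover G S → HasONCF G (∣ S ∣ + 1))
    × ((S : Subset n) → IsVertexCover G S → ¬ IsStar G → ¬ IsEdgeStar G → HasONCF G ∣ S ∣)
theorem10 {suc _} G 2≤n conn =
    (λ _ D → treewidth-bound G nb D)
  , fvs-bound G nb
  , vc-bound G nb
  , λ S cover ¬star ¬edgeStar → sharp-vc-bound G nb S cover conn ¬star ¬edgeStar zero
  where
  nb : ∀ v → ∃[ u ] Adj G v u
  nb = connected⇒neighbour G 2≤n conn
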